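{- For all integers $r,s\ge 1$, $\chi_{ltna}(rK_2\vee O_{2s+1})=3$.
   Context: All graphs are finite and simple. $rK_2$ is the disjoint union of $r$ copies of $K_2$. $O_m$ is the null (edgeless) graph on $m$ vertices. The join $G\vee H$ of (vertex-disjoint) graphs has $V(G\vee H)=V(G)\cup V(H)$ and $E(G\vee H)=E(G)\cup E(H)\cup\{uv\mid u\in V(G),v\in V(H)\}$. For a graph $G=(V,E)$ of order $p$ and size $q$ without isolated vertices, a bijection $f:V\cup E\to\{1,\dots,p+q\}$ is a local total neighborhood antimagic labeling of $G$ if the induced vertex coloring $f^+_{tn}(u)=\sum_{ux\in E}[f(ux)+f(x)]$ satisfies $f^+_{tn}(u)\ne f^+_{tn}(v)$ for every edge $uv\in E$. The number of distinct induced colors is $c_{tn}(f)$. The local total neighborhood antimagic chromatic number $\chi_{ltna}(G)$ is the minimum of $c_{tn}(f)$ over all local total neighborhood antimagic labelings $f$ of $G$; an assertion $\chi_{ltna}(G)=k$ includes the assertion that $G$ admits such a labeling. -}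

module Defs where

open import Level using (0ℓ)
open import Data.Empty using (⊥; ⊥-elim-irr)
open import Data.Unit using (⊤; tt)
open import Data.Nat.Base using (ℕ; suc; _+_; _*_; _≤_)
open import Data.Nat.Properties using (+-0-commutativeMonoid) renaming (_≟_ to _≟ℕ_)
open import Data.Fin.Base using (Fin; toℕ; _<_)
open import Data.Fin.Properties using (_≟_; _<?_; <-cmp; +↔⊎; *↔×)
open import Data.List.Base using (length; map; filter; cartesianProduct; allFin; deduplicate)
open import Data.Product.Base using (∃; _×_; _,_; proj₁; proj₂)
open import Data.Product.Function.NonDependent.Propositional using (_×-↔_)
open import Data.Sum.Base using (_⊎_; inj₁; inj₂)
open import Data.Sum.Function.Propositional using (_⊎-↔_)
open import Function.Base using (_∘_)
open import Function.Bundles using (_↔_; _⤖_; module Inverse; module Bijection)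
open import Function.Construct.Composition using (_↔-∘_)
open import Function.Construct.Identity using (↔-id)
open import Relation.Binary.Core using (Rel)
open import Relation.Binary.Definitions
  using (Decidable; Symmetric; tri<; tri≈; tri>)
open import Relation.Binary.PropositionalEquality
  using (_≡_; _≢_; refl; sym; trans; cong; subst)
open import Relation.Nullary using (¬_; Dec; yes; no; ¬?; _×-dec_)
open import Algebra.Properties.CommutativeMonoid.Sum +-0-commutativeMonoid using (sum)

record Graph : Set₁ where
  field
    V       : Set
    order   : ℕ
    enum    : Fin order ↔ V
    Adj     : Rel V 0ℓ
    adj?    : Decidable Adj
    adj-sym : Symmetric Adj
    irrefl  : ∀ {u} → ¬ Adj u u

  vertex : Fin order → V
  vertex = Inverse.to enum

  index : V → Fin order
  index = Inverse.from enum

  index-injective : ∀ {u v} → index u ≡ index v → u ≡ v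
  index-injective {u} {v} eq =
    trans (sym (Inverse.strictlyInverseˡ enum u))
          (trans (cong vertex eq) (Inverse.strictlyInverseˡ enum v))

  -- An undirected edge {lo, hi} is represented once, with its endpoints in
  -- the order of the enumeration.  The proof fields are irrelevant, so an
  -- edge is determined by its endpoints.
  record Edge : Set where
    constructor mkEdge
    field
      lo hi     : V
      .ordered  : index lo < index hi
      .adjacent : Adj lo hi

  edge : ∀ u v → .(Adj u v) → Edge
  edge u v a with <-cmp (index u) (index v)
  ... | tri< u<v _ _ = mkEdge u v u<v a
  ... | tri> _ _ v<u = mkEdge v u v<u (adj-sym a)
  ... | tri≈ _ u≈v _ =
    ⊥-elim-irr (irrefl (subst (Adj u) (sym (index-injective u≈v)) a))

  edgeIndices? : (ij : Fin order × Fin order) →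
                 Dec (proj₁ ij < proj₂ ij × Adj (vertex (proj₁ ij)) (vertex (proj₂ ij)))
  edgeIndices? (i , j) = (i <? j) ×-dec adj? (vertex i) (vertex j)

  size : ℕ
  size = length (filter edgeIndices? (cartesianProduct (allFin order) (allFin order)))

  NoIsolatedVertex : Set
  NoIsolatedVertex = ∀ u → ∃ λ v → Adj u v

open Graph using (V; Adj)

complete : ℕ → Graph
complete n = record
  { V = Fin n ; order = n ; enum = ↔-id (Fin n)
  ; Adj = _≢_ ; adj? = λ i j → ¬? (i ≟ j)
  ; adj-sym = λ i≢j → i≢j ∘ sym ; irrefl = λ i≢i → i≢i refl }

O : ℕ → Graph
O m = record
  { V = Fin m ; order = m ; enum = ↔-id (Fin m)
  ; Adj = λ _ _ → ⊥ ; adj? = λ _ _ → no λ ()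
  ; adj-sym = λ () ; irrefl = λ () }

copies : ℕ → Graph → Graph
copies r G = record
  { V = Fin r × G.V ; order = r * G.order
  ; enum = (↔-id (Fin r) ×-↔ G.enum) ↔-∘ *↔×
  ; Adj = λ (i , u) (j , v) → i ≡ j × G.Adj u v
  ; adj? = λ (i , u) (j , v) → (i ≟ j) ×-dec G.adj? u v
  ; adj-sym = λ (i≡j , a) → sym i≡j , G.adj-sym a
  ; irrefl = λ (_ , a) → G.irrefl a }
  where module G = Graph G

infixr 6 _∨_

_∨_ : Graph → Graph → Graph
G ∨ H = record
  { V = G.V ⊎ H.V ; order = G.order + H.order
  ; enum = (G.enum ⊎-↔ H.enum) ↔-∘ +↔⊎
  ; Adj = JoinAdj ; adj? = joinAdj?
  ; adj-sym = λ {x} {y} → joinSym x y ; irrefl = λ {x} → joinIrrefl x }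
  where
  module G = Graph G
  module H = Graph H

  JoinAdj : Rel (G.V ⊎ H.V) 0ℓ
  JoinAdj (inj₁ u) (inj₁ v) = G.Adj u v
  JoinAdj (inj₁ _) (inj₂ _) = ⊤
  JoinAdj (inj₂ _) (inj₁ _) = ⊤
  JoinAdj (inj₂ u) (inj₂ v) = H.Adj u v

  joinAdj? : Decidable JoinAdj
  joinAdj? (inj₁ u) (inj₁ v) = G.adj? u v
  joinAdj? (inj₁ _) (inj₂ _) = yes tt
  joinAdj? (inj₂ _) (inj₁ _) = yes tt
  joinAdj? (inj₂ u) (inj₂ v) = H.adj? u v

  joinSym : ∀ x y → JoinAdj x y → JoinAdj y x
  joinSym (inj₁ u) (inj₁ v) a = G.adj-sym a
  joinSym (inj₁ _) (inj₂ _) _ = tt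
  joinSym (inj₂ _) (inj₁ _) _ = tt
  joinSym (inj₂ u) (inj₂ v) a = H.adj-sym a

  joinIrrefl : ∀ x → ¬ JoinAdj x x
  joinIrrefl (inj₁ u) = G.irrefl
  joinIrrefl (inj₂ u) = H.irrefl

module Labeling (G : Graph) where
  open Graph G hiding (V; Adj)

  TotalLabeling : Set
  TotalLabeling = (V G ⊎ Edge) ⤖ Fin (order + size)

  module _ (f : TotalLabeling) where

    -- Fin (order + size) is shifted by one to represent {1, …, order + size}.
    label : V G ⊎ Edge → ℕ
    label x = suc (toℕ (Bijection.to f x))

    weight : (u x : V G) → Dec (Adj G u x) → ℕ
    weight u x (yes a) = label (inj₂ (edge u x a)) + label (inj₁ x)
    weight u x (no  _) = 0

    color : V G → ℕ
    color u = sum λ i → weight u (vertex i) (adj? u (vertex i))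

    IsLocalTotalNeighborhoodAntimagic : Set
    IsLocalTotalNeighborhoodAntimagic = ∀ u v → Adj G u v → color u ≢ color v

    numColors : ℕ
    numColors = length (deduplicate _≟ℕ_ (map (color ∘ vertex) (allFin order)))

-- The minimum need not exist for an arbitrary graph, so "χ_ltna(G) = k" is a
-- relation between G and k.
record χltna[_]≡_ (G : Graph) (k : ℕ) : Set where
  open Labeling G
  field
    noIsolated : Graph.NoIsolatedVertex G
    attained   : ∃ λ f → IsLocalTotalNeighborhoodAntimagic f × numColors f ≡ k
    minimal    : ∀ f → IsLocalTotalNeighborhoodAntimagic f → k ≤ numColors f

{-# OPTIONS --safe #-}

-- Upper bound: give the two spokes from a K₂ to a hub complementary labels p and
-- q with p + q = K.  Then all hubs receive the same color.  Over the i-th K₂,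
-- the p-labels of the first hub grow with slope 2 in i, those of s + 1 of the
-- other hubs with slope −1 and those of the remaining s − 1 hubs with slope 1,
-- so their sum does not depend on i; the label of the K₂-edge (slope 1) balances
-- those of its endpoints (slope −1), and the hubs take the leftover labels.  So
-- the two sides of the matching have constant colors α and β.  The two spoke
-- sums add up to the odd number (2s + 1)K, and the two blocks of endpoint labels
-- differ by 2r, so α ≠ β.  Exchanging these blocks changes the pair (α, β) but
-- not the hub color, and one of the two versions separates all three colors.
-- Lower bound: the graph contains a triangle.

module Submission where

open import Defs
open import Data.Bool.Base using (Bool; true; false)
open import Data.Empty using (⊥-elim-irr)
open import Data.Fin.Base
  using (Fin; zero; suc; toℕ; cast; opposite; splitAt; combine; _↑ˡ_; _↑ʳ_; _<_)
open import Data.Fin.Patterns using (0F; 1F; 2F)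
open import Data.Fin.Properties
  using (_≟_; _<?_; <-cmp; <-asym; injective⇒≤; suc-injective; toℕ<n; opposite-prop
        ; opposite-involutive; +↔⊎; *↔×; splitAt-↑ˡ; splitAt-↑ʳ; remQuot-combine; toℕ-cast; toℕ-combine; toℕ-↑ˡ; toℕ-↑ʳ
        ; cast-involutive)
open import Data.List.Base
  using (List; []; _∷_; length; lookup; map; filter; allFin; cartesianProduct; deduplicate)
open import Data.List.Membership.Propositional using (_∈_)
open import Data.List.Membership.Propositional.Properties
  using (∈-lookup; ∈-filter⁺; ∈-filter⁻; ∈-cartesianProduct⁺; ∈-allFin; ∈-map⁺; ∈-map⁻
        ; ∈-deduplicate⁺; ∈-deduplicate⁻)
open import Data.List.Relation.Binary.Subset.Propositional using (_⊆_)
open import Data.List.Relation.Unary.All as All using ([]; _∷_)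
open import Data.List.Relation.Unary.AllPairs.Core using ([]; _∷_)
open import Data.List.Relation.Unary.Any as Any using (here; there)
open import Data.List.Relation.Unary.Any.Properties using (lookup-index)
open import Data.List.Relation.Unary.Unique.Propositional using (Unique)
open import Data.List.Relation.Unary.Unique.Propositional.Properties
  using (allFin⁺; cartesianProduct⁺; filter⁺)
open import Data.Nat.Base using (ℕ; zero; suc; _+_; _*_; _≤_)
open import Data.Nat.Properties
  using (≤-antisym; +-assoc; +-comm; +-suc; +-identityʳ; +-cancelˡ-≡; +-cancelʳ-≡; m+[n∸m]≡n
        ; m≢1+m+n; even≢odd; +-0-commutativeMonoid)
  renaming (_≟_ to _≟ℕ_)
open import Algebra.Properties.CommutativeMonoid.Sum +-0-commutativeMonoid
  using (sum; sum-cong-≗; sum-replicate-zero; ∑-distrib-+)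
open import Data.List.Relation.Unary.Unique.DecPropositional.Properties _≟ℕ_ using (deduplicate-!)
open import Data.Nat.Tactic.RingSolver using (solve-∀)
open import Data.Product.Base using (∃; _×_; _,_; proj₁; proj₂)
open import Data.Product.Function.NonDependent.Propositional using (_×-↔_)
open import Data.Product.Properties using (,-injectiveˡ; ,-injectiveʳ)
open import Data.Sum.Base using (_⊎_; inj₁; inj₂)
open import Data.Sum.Function.Propositional using (_⊎-↔_)
open import Data.Unit.Base using (tt)
open import Function.Base using (_∘_; id)
open import Function.Bundles using (_↔_; mk↔ₛ′; module Inverse)
open import Function.Construct.Composition using (_↔-∘_)
open import Function.Construct.Identity using (↔-id)
open import Function.Construct.Symmetry using (↔-sym)
open import Function.Definitions using (Injective)
open import Function.Properties.Inverse using (↔⇒⤖)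
open import Relation.Binary.Definitions using (tri<; tri≈; tri>)
open import Relation.Binary.PropositionalEquality
open import Relation.Nullary using (Dec; ¬_; yes; no; recompute; contradiction)

-- Duplicate-free lists and finite sums.

lookup-injective : ∀ {A : Set} {xs : List A} → Unique xs → Injective _≡_ _≡_ (lookup xs)
lookup-injective (_ ∷ _)   {zero}  {zero}  _  = refl
lookup-injective {xs = _ ∷ _} (x∉ ∷ _) {zero}  {suc j} eq =
  contradiction eq (All.lookup x∉ (∈-lookup j))
lookup-injective {xs = _ ∷ _} (x∉ ∷ _) {suc i} {zero}  eq =
  contradiction (sym eq) (All.lookup x∉ (∈-lookup i))
lookup-injective (_ ∷ xs!) {suc i} {suc j} eq = cong suc (lookup-injective xs! eq)

-- Sending each position of `xs` to a position of the same entry in `ys` is injective. Both bounds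
-- on the number of colors come from this comparison.
unique-⊆⇒length-≤ : ∀ {A : Set} {xs ys : List A} →
                    Unique xs → xs ⊆ ys → length xs ≤ length ys
unique-⊆⇒length-≤ {xs = xs} {ys} xs! xs⊆ys = injective⇒≤ {f = f} f-injective
  where
  f : Fin (length xs) → Fin (length ys)
  f i = Any.index (xs⊆ys (∈-lookup i))

  f-injective : Injective _≡_ _≡_ f
  f-injective {i} {j} eq = lookup-injective xs! (begin
    lookup xs i       ≡⟨ lookup-index (xs⊆ys (∈-lookup i)) ⟩
    lookup ys (f i)   ≡⟨ cong (lookup ys) eq ⟩
    lookup ys (f j)   ≡⟨ lookup-index (xs⊆ys (∈-lookup j)) ⟨
    lookup xs j       ∎)
    where open ≡-Reasoning

sum-↑ : ∀ m {n} (f : Fin (m + n) → ℕ) → sum f ≡ sum (f ∘ (_↑ˡ n)) + sum (f ∘ (m ↑ʳ_))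
sum-↑ zero    f = refl
sum-↑ (suc m) f = trans (cong (f zero +_) (sum-↑ m (f ∘ suc))) (sym (+-assoc (f zero) _ _))

sum-combine : ∀ m n (f : Fin (m * n) → ℕ) →
              sum f ≡ sum {m} (λ i → sum {n} (λ j → f (combine i j)))
sum-combine zero    n f = refl
sum-combine (suc m) n f =
  trans (sum-↑ n f) (cong (sum (f ∘ (_↑ˡ (m * n))) +_) (sum-combine m n (f ∘ (n ↑ʳ_))))

sum-single : ∀ {n} (f : Fin n → ℕ) i → (∀ j → i ≢ j → f j ≡ 0) → sum f ≡ f i
sum-single {suc n} f zero others = trans
  (cong (f zero +_) (trans (sum-cong-≗ (λ j → others (suc j) λ ())) (sum-replicate-zero n)))
  (+-identityʳ (f zero))
sum-single f (suc i) others
  rewrite others zero (λ ()) = sum-single (f ∘ suc) i (λ j i≢j → others (suc j) (i≢j ∘ suc-injective))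

-- Edges, size and weights in an arbitrary graph.

module GraphProperties (G : Graph) where
  open Graph G
  open Labeling G

  -- The two comparisons fall into opposite strict cases, so both calls store the same ordered pair.
  -- A color reads each edge from the vertex being colored, so the two ends of an edge must agree on
  -- its label.
  edge-sym : ∀ u v .(a : Adj u v) .(a′ : Adj v u) → edge u v a ≡ edge v u a′
  edge-sym u v a a′ with <-cmp (index u) (index v) | <-cmp (index v) (index u)
  ... | tri< _ _ _   | tri> _ _ _   = refl
  ... | tri> _ _ _   | tri< _ _ _   = refl
  ... | tri< p _ _   | tri< q _ _   = contradiction q (<-asym p)
  ... | tri> _ _ p   | tri> _ _ q   = contradiction q (<-asym p)
  ... | tri≈ _ u≈v _ | _ = ⊥-elim-irr (irrefl (subst (Adj u) (sym (index-injective u≈v)) a))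
  ... | _ | tri≈ _ v≈u _ = ⊥-elim-irr (irrefl (subst (Adj v) (sym (index-injective v≈u)) a′))

  edge-ordered : ∀ {lo hi} .(lo<hi : index lo < index hi) .(a : Adj lo hi) →
                 edge lo hi a ≡ mkEdge lo hi lo<hi a
  edge-ordered {lo} {hi} lo<hi a with <-cmp (index lo) (index hi)
  ... | tri< _ _ _    = refl
  ... | tri≈ lo≮hi _ _ = ⊥-elim-irr (lo≮hi lo<hi)
  ... | tri> lo≮hi _ _ = ⊥-elim-irr (lo≮hi lo<hi)

  -- The filtered list of index pairs and the type `Edge` inject into each other. This replaces the
  -- filtered count, which does not compute for a variable graph, by the size of any explicit
  -- enumeration of the edges.
  size≡ : ∀ {n} → Fin n ↔ Edge → size ≡ n
  size≡ {n} F = ≤-antisym (injective⇒≤ {f = from ∘ toEdge} (toEdge-injective ∘ from-injective))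
                          (injective⇒≤ {f = position ∘ to} (to-injective ∘ position-injective))
    where
    open Inverse F using (to; from; strictlyInverseˡ; strictlyInverseʳ)
    pairs = cartesianProduct (allFin order) (allFin order)
    edges = filter edgeIndices? pairs

    to-injective : Injective _≡_ _≡_ to
    to-injective eq = trans (sym (strictlyInverseʳ _)) (trans (cong from eq) (strictlyInverseʳ _))

    from-injective : Injective _≡_ _≡_ from
    from-injective eq = trans (sym (strictlyInverseˡ _)) (trans (cong to eq) (strictlyInverseˡ _))

    edges! : Unique edges
    edges! = filter⁺ edgeIndices? (cartesianProduct⁺ (allFin⁺ order) (allFin⁺ order))

    index-vertex : ∀ i → index (vertex i) ≡ i
    index-vertex = Inverse.strictlyInverseʳ enum

    vertex-index : ∀ u → vertex (index u) ≡ u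
    vertex-index = Inverse.strictlyInverseˡ enum

    toEdge : Fin size → Edge
    toEdge k with lookup edges k | ∈-filter⁻ edgeIndices? {xs = pairs} (∈-lookup {xs = edges} k)
    ... | i , j | _ , i<j , a =
      mkEdge (vertex i) (vertex j) (subst₂ _<_ (sym (index-vertex i)) (sym (index-vertex j)) i<j) a

    endpoints : Edge → Fin order × Fin order
    endpoints e = index (Edge.lo e) , index (Edge.hi e)

    endpoints-toEdge : ∀ k → endpoints (toEdge k) ≡ lookup edges k
    endpoints-toEdge k with lookup edges k | ∈-filter⁻ edgeIndices? {xs = pairs} (∈-lookup {xs = edges} k)
    ... | i , j | _ , i<j , a = cong₂ _,_ (index-vertex i) (index-vertex j)

    toEdge-injective : Injective _≡_ _≡_ toEdge
    toEdge-injective {k} {l} eq = lookup-injective edges!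
      (trans (sym (endpoints-toEdge k))
      (trans (cong endpoints eq) (endpoints-toEdge l)))

    endpoints∈edges : ∀ e → endpoints e ∈ edges
    endpoints∈edges (mkEdge lo hi lo<hi a) =
      ∈-filter⁺ edgeIndices? (∈-cartesianProduct⁺ (∈-allFin _) (∈-allFin _))
        -- List membership needs relevant proofs, which decidability recovers from the irrelevant
        -- fields.
        ( recompute (_ <? _) lo<hi
        , subst₂ Adj (sym (vertex-index lo)) (sym (vertex-index hi)) (recompute (adj? lo hi) a))

    position : Edge → Fin size
    position e = Any.index (endpoints∈edges e)

    position-injective : Injective _≡_ _≡_ position
    position-injective {e} {e′} eq = edge-≡ (,-injectiveˡ same) (,-injectiveʳ same)
      where
      same : endpoints e ≡ endpoints e′
      same = trans (lookup-index (endpoints∈edges e))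
             (trans (cong (lookup edges) eq) (sym (lookup-index (endpoints∈edges e′))))
      edge-≡ : index (Edge.lo e) ≡ index (Edge.lo e′) →
               index (Edge.hi e) ≡ index (Edge.hi e′) → e ≡ e′
      edge-≡ p q with refl ← index-injective p | refl ← index-injective q = refl

  module _ (f : TotalLabeling) where

    -- Whichever adjacency proof the decision `d` carries, the edge is the same, since `edge` takes
    -- that proof irrelevantly.
    weight-adjacent : ∀ {u x} (d : Dec (Adj u x)) (a : Adj u x) →
                      weight f u x d ≡
                        label f (inj₂ (edge u x a)) + label f (inj₁ x)
    weight-adjacent (yes _) a = refl
    weight-adjacent (no ¬a) a = contradiction a ¬a

    weight-nonadjacent : ∀ {u x} (d : Dec (Adj u x)) → ¬ Adj u x → weight f u x d ≡ 0
    weight-nonadjacent (yes a) ¬a = contradiction a ¬a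
    weight-nonadjacent (no _)  _  = refl

opposite-sum : ∀ {n} (i : Fin n) → suc (toℕ i + toℕ (opposite i)) ≡ n
opposite-sum {n} i rewrite opposite-prop i = m+[n∸m]≡n (toℕ<n i)

sum-const : ∀ n c → sum {n} (λ _ → c) ≡ n * c
sum-const zero    c = refl
sum-const (suc n) c = cong (c +_) (sum-const n c)

-- Edges and colors of the join of a matching and a null graph.

module MatchingJoin (r m : ℕ) where

  G : Graph
  G = copies r (complete 2) ∨ O m

  open Graph G
  open GraphProperties G
  open Labeling G

  -- Edges without their orientation: the left summand holds the matching edges, the right one the
  -- spokes from an end of a K₂ to a hub.
  EdgeKind : Set
  EdgeKind = Fin r ⊎ ((Fin r × Fin 2) × Fin m)

  kind : Edge → EdgeKind
  kind (mkEdge (inj₁ (i , _)) (inj₁ _) _ _) = inj₁ i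
  kind (mkEdge (inj₁ w) (inj₂ j) _ _) = inj₂ (w , j)
  kind (mkEdge (inj₂ j) (inj₁ w) _ _) = inj₂ (w , j)
  kind (mkEdge (inj₂ _) (inj₂ _) _ a) = ⊥-elim-irr a

  rung : Fin r → Edge
  rung i = edge (inj₁ (i , 0F)) (inj₁ (i , 1F)) (refl , λ ())

  spoke : Fin r × Fin 2 → Fin m → Edge
  spoke w j = edge (inj₁ w) (inj₂ j) tt

  fromKind : EdgeKind → Edge
  fromKind (inj₁ i) = rung i
  fromKind (inj₂ (w , j)) = spoke w j

  kind-fromKind : ∀ k → kind (fromKind k) ≡ k
  kind-fromKind (inj₁ i)
    with <-cmp (index (inj₁ (i , 0F))) (index (inj₁ (i , 1F)))
  ... | tri< _ _ _  = refl
  ... | tri> _ _ _  = refl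
  ... | tri≈ _ eq _ = contradiction (index-injective {inj₁ (i , 0F)} {inj₁ (i , 1F)} eq) λ ()
  kind-fromKind (inj₂ (w , j))
    with <-cmp (index (inj₁ w)) (index (inj₂ j))
  ... | tri< _ _ _  = refl
  ... | tri> _ _ _  = refl
  ... | tri≈ _ eq _ = contradiction (index-injective {inj₁ w} {inj₂ j} eq) λ ()

  fromKind-kind : ∀ e → fromKind (kind e) ≡ e
  fromKind-kind (mkEdge (inj₁ (i , b)) (inj₁ (j , c)) o a)
    -- Adjacent leaves lie in the same K₂; recomputing this equality makes it available for
    -- matching.
    with refl ← recompute (i ≟ j) (proj₁ a) = go b c o a
    where
    go : ∀ b c
         .(o : index (inj₁ (i , b)) < index (inj₁ (i , c)))
         .(a : Adj (inj₁ (i , b)) (inj₁ (i , c))) →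
         rung i ≡ mkEdge (inj₁ (i , b)) (inj₁ (i , c)) o a
    go 0F 0F o a = ⊥-elim-irr (proj₂ a refl)
    go 0F 1F o a = edge-ordered o a
    go 1F 0F o a = trans (edge-sym (inj₁ (i , 0F)) (inj₁ (i , 1F)) _ a) (edge-ordered o a)
    go 1F 1F o a = ⊥-elim-irr (proj₂ a refl)
  fromKind-kind (mkEdge (inj₁ w) (inj₂ j) o a) = edge-ordered o a
  fromKind-kind (mkEdge (inj₂ j) (inj₁ w) o a) =
    trans (edge-sym (inj₁ w) (inj₂ j) tt tt) (edge-ordered o a)
  fromKind-kind (mkEdge (inj₂ _) (inj₂ _) _ a) = ⊥-elim-irr a

  kind↔ : Edge ↔ EdgeKind
  kind↔ = mk↔ₛ′ kind fromKind kind-fromKind fromKind-kind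

  size≡kinds : size ≡ r + (r * 2) * m
  size≡kinds = size≡ (↔-sym kind↔ ↔-∘ ((↔-id _ ⊎-↔ ((*↔× ×-↔ ↔-id _) ↔-∘ *↔×)) ↔-∘ +↔⊎))

  vertex-leaf : ∀ i b → vertex (combine i b ↑ˡ m) ≡ inj₁ (i , b)
  vertex-leaf i b rewrite splitAt-↑ˡ (r * 2) (combine i b) m | remQuot-combine i b = refl

  vertex-hub : ∀ j → vertex ((r * 2) ↑ʳ j) ≡ inj₂ j
  vertex-hub j rewrite splitAt-↑ʳ (r * 2) m j = refl

  sum-vertices : (h : V → ℕ) → sum (h ∘ vertex) ≡
                 sum {r} (λ i → sum {2} (λ b → h (inj₁ (i , b)))) + sum {m} (h ∘ inj₂)
  sum-vertices h = trans (sum-↑ (r * 2) (h ∘ vertex)) (cong₂ _+_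
    (trans (sum-combine r 2 _) (sum-cong-≗ λ i → sum-cong-≗ λ b → cong h (vertex-leaf i b)))
    (sum-cong-≗ λ j → cong h (vertex-hub j)))

  module _ (f : TotalLabeling) where

    leafLabel : Fin r → Fin 2 → ℕ
    leafLabel i b = label f (inj₁ (inj₁ (i , b)))

    hubLabel : Fin m → ℕ
    hubLabel j = label f (inj₁ (inj₂ j))

    rungLabel : Fin r → ℕ
    rungLabel i = label f (inj₂ (rung i))

    spokeLabel : Fin r → Fin 2 → Fin m → ℕ
    spokeLabel i b j = label f (inj₂ (spoke (i , b) j))

    -- The neighbors of a leaf are its partner, indexed by `opposite b`, and all hubs; the other
    -- copies of K₂ contribute zero.
    color-leaf : ∀ i b → color f (inj₁ (i , b)) ≡
                 (rungLabel i + leafLabel i (opposite b)) + sum (λ j → spokeLabel i b j + hubLabel j)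
    color-leaf i b = trans (sum-vertices (λ x → weight f u x (adj? u x)))
      (cong (_+ sum (λ j → spokeLabel i b j + hubLabel j))
        (trans (sum-single (λ j → sum {2} (λ c → w j c)) i elsewhere) (here-sum b refl)))
      where
      u = inj₁ (i , b)
      w : Fin r → Fin 2 → ℕ
      w j c = weight f u (inj₁ (j , c)) (adj? u (inj₁ (j , c)))

      elsewhere : ∀ j → i ≢ j → sum {2} (w j) ≡ 0
      elsewhere j i≢j = trans (sum-cong-≗ {2} (λ c →
          weight-nonadjacent f {u} {inj₁ (j , c)} (adj? u (inj₁ (j , c))) (i≢j ∘ proj₁)))
        (sum-replicate-zero 2)

      -- The extra variable `b′` permits a case split on `b`, on which `u` and `w` already depend.
      here-sum : ∀ b′ → b ≡ b′ → sum {2} (w i) ≡ rungLabel i + leafLabel i (opposite b)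
      here-sum 0F refl = cong₂ _+_
        (weight-nonadjacent f {u} {u} (adj? u u) (irrefl {u}))
        (trans (+-identityʳ _) (weight-adjacent f {u} {inj₁ (i , 1F)} (adj? u (inj₁ (i , 1F))) (refl , λ ())))
      here-sum 1F refl = trans (cong₂ _+_
        (weight-adjacent f {u} {inj₁ (i , 0F)} (adj? u (inj₁ (i , 0F))) (refl , λ ()))
        (trans (+-identityʳ _) (weight-nonadjacent f {u} {u} (adj? u u) (irrefl {u}))))
        (trans (+-identityʳ _) (cong (λ e → label f (inj₂ e) + leafLabel i 0F) (edge-sym u (inj₁ (i , 0F)) _ _)))

    color-hub : ∀ j → color f (inj₂ j) ≡
                sum (λ i → sum (λ b → spokeLabel i b j + leafLabel i b))
    color-hub j = trans (sum-vertices (λ x → weight f (inj₂ j) x (adj? (inj₂ j) x)))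
      (trans (cong₂ _+_
        (sum-cong-≗ {r} λ i → sum-cong-≗ {2} λ b →
          cong (λ e → label f (inj₂ e) + leafLabel i b) (edge-sym (inj₂ j) (inj₁ (i , b)) tt tt))
        (sum-replicate-zero m)) (+-identityʳ _))

    -- The two ends of a K₂ and a hub form a triangle, so their colors are pairwise distinct.
    three≤numColors : Fin r → Fin m → IsLocalTotalNeighborhoodAntimagic f → 3 ≤ numColors f
    three≤numColors i j proper = unique-⊆⇒length-≤ distinct present
      where
      u = inj₁ (i , 0F)
      v = inj₁ (i , 1F)
      x = inj₂ j
      distinct = (proper u v (refl , λ ()) ∷ proper u x tt ∷ []) ∷ (proper v x tt ∷ []) ∷ [] ∷ []

      color∈ : ∀ y → color f y ∈ deduplicate _≟ℕ_ (map (color f ∘ vertex) (allFin order))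
      color∈ y = ∈-deduplicate⁺ _≟ℕ_ (subst (λ z → color f z ∈ _) (Inverse.strictlyInverseˡ enum y)
        (∈-map⁺ (color f ∘ vertex) (∈-allFin (index y))))

      present : ∀ {c} → c ∈ color f u ∷ color f v ∷ color f x ∷ [] →
                c ∈ deduplicate _≟ℕ_ (map (color f ∘ vertex) (allFin order))
      present (here refl) = color∈ u
      present (there (here refl)) = color∈ v
      present (there (there (here refl))) = color∈ x

    module _ {α β γ : ℕ}
             (leaf₀ : ∀ i → color f (inj₁ (i , 0F)) ≡ α)
             (leaf₁ : ∀ i → color f (inj₁ (i , 1F)) ≡ β)
             (hub   : ∀ j → color f (inj₂ j) ≡ γ) where

      numColors≤3 : numColors f ≤ 3
      numColors≤3 = unique-⊆⇒length-≤ {ys = α ∷ β ∷ γ ∷ []} (deduplicate-! _) λ c∈ →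
        found (∈-map⁻ (color f ∘ vertex) (∈-deduplicate⁻ _≟ℕ_ _ c∈))
        where
        three : ∀ v → color f v ∈ α ∷ β ∷ γ ∷ []
        three (inj₁ (i , 0F)) = here (leaf₀ i)
        three (inj₁ (i , 1F)) = there (here (leaf₁ i))
        three (inj₂ j)        = there (there (here (hub j)))
        found : ∀ {c} → ∃ (λ k → k ∈ allFin order × c ≡ color f (vertex k)) → c ∈ α ∷ β ∷ γ ∷ []
        found (k , _ , refl) = three (vertex k)

      antimagic : α ≢ β → α ≢ γ → β ≢ γ → IsLocalTotalNeighborhoodAntimagic f
      antimagic α≢β α≢γ β≢γ = proper
        where
        distinct : ∀ {x y c d} → x ≡ c → y ≡ d → c ≢ d → x ≢ y
        distinct refl refl c≢d = c≢d

        proper : IsLocalTotalNeighborhoodAntimagic f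
        proper (inj₁ (i , 0F)) (inj₁ (j , 0F)) (_ , ≢) = contradiction refl ≢
        proper (inj₁ (i , 0F)) (inj₁ (j , 1F)) _ = distinct (leaf₀ i) (leaf₁ j) α≢β
        proper (inj₁ (i , 1F)) (inj₁ (j , 0F)) _ = distinct (leaf₁ i) (leaf₀ j) (≢-sym α≢β)
        proper (inj₁ (i , 1F)) (inj₁ (j , 1F)) (_ , ≢) = contradiction refl ≢
        proper (inj₁ (i , 0F)) (inj₂ j) _ = distinct (leaf₀ i) (hub j) α≢γ
        proper (inj₁ (i , 1F)) (inj₂ j) _ = distinct (leaf₁ i) (hub j) β≢γ
        proper (inj₂ j) (inj₁ (i , 0F)) _ = distinct (hub j) (leaf₀ i) (≢-sym α≢γ)
        proper (inj₂ j) (inj₁ (i , 1F)) _ = distinct (hub j) (leaf₁ i) (≢-sym β≢γ)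

-- The balanced labeling.

reflect : ∀ {a b n} → Fin a ⊎ Fin b → Fin n → Fin n
reflect (inj₁ _) = opposite
reflect (inj₂ _) = id

reflect-involutive : ∀ {a b n} (k : Fin a ⊎ Fin b) (i : Fin n) → reflect k (reflect k i) ≡ i
reflect-involutive (inj₁ _) = opposite-involutive
reflect-involutive (inj₂ _) _ = refl

-- Besides the first hub, `s` hubs have slope -1 and `t` have slope 1 in the copy index. The
-- hypothesis says that the total slope 2 - `s` + `t` vanishes. In terms of the theorem's s, these
-- counts are s + 1 and s - 1.
module Balanced (r s t : ℕ) (s≡2+t : s ≡ 2 + t) where

  n : ℕ
  n = s + t

  open MatchingJoin r (suc n)
  open Graph G
  open Labeling G

  π : Fin n → Fin r → Fin r
  π j = reflect (splitAt s j)

  π-involutive : ∀ j i → π j (π j i) ≡ i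
  π-involutive j = reflect-involutive (splitAt s j)

  -- Consecutive blocks of labels; upper mirrors lower about centre.  The edges of
  -- the matching take block 1F of own and its two sides take blocks 0F and 2F,
  -- which makes the difference of the latter even.
  Slot : Set
  Slot = (Fin n × Fin r) ⊎ (Fin r × Fin 2) ⊎ (Fin n × Fin r) ⊎ (Fin 3 × Fin r) ⊎ Fin (suc n)

  pattern lower x  = inj₁ x
  pattern centre x = inj₂ (inj₁ x)
  pattern upper x  = inj₂ (inj₂ (inj₁ x))
  pattern own x    = inj₂ (inj₂ (inj₂ (inj₁ x)))
  pattern hub j    = inj₂ (inj₂ (inj₂ (inj₂ j)))

  N : ℕ
  N = n * r + (r * 2 + (n * r + (3 * r + suc n)))

  slot↔ : Fin N ↔ Slot
  slot↔ = (*↔× ⊎-↔ ((*↔× ⊎-↔ ((*↔× ⊎-↔ ((*↔× ⊎-↔ ↔-id _) ↔-∘ +↔⊎)) ↔-∘ +↔⊎)) ↔-∘ +↔⊎)) ↔-∘ +↔⊎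

  value : Slot → ℕ
  value s = suc (toℕ (Inverse.from slot↔ s))

  value-lower : ∀ j i → value (lower (j , i)) ≡ suc (r * toℕ j + toℕ i)
  value-lower j i = cong suc (trans (toℕ-↑ˡ (combine j i) _) (toℕ-combine j i))

  value-centre : ∀ i b → value (centre (i , b)) ≡ suc (n * r + (2 * toℕ i + toℕ b))
  value-centre i b = cong suc (trans (toℕ-↑ʳ (n * r) _) (cong (n * r +_)
    (trans (toℕ-↑ˡ (combine i b) _) (toℕ-combine i b))))

  value-upper : ∀ j i → value (upper (j , i)) ≡ suc (n * r + (r * 2 + (r * toℕ j + toℕ i)))
  value-upper j i = cong suc (trans (toℕ-↑ʳ (n * r) _) (cong (n * r +_)
    (trans (toℕ-↑ʳ (r * 2) _) (cong (r * 2 +_) (trans (toℕ-↑ˡ (combine j i) _) (toℕ-combine j i))))))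

  value-own : ∀ b i → value (own (b , i)) ≡ suc (n * r + (r * 2 + (n * r + (r * toℕ b + toℕ i))))
  value-own b i = cong suc (trans (toℕ-↑ʳ (n * r) _) (cong (n * r +_)
    (trans (toℕ-↑ʳ (r * 2) _) (cong (r * 2 +_)
    (trans (toℕ-↑ʳ (n * r) _) (cong (n * r +_) (trans (toℕ-↑ˡ (combine b i) _) (toℕ-combine b i))))))))

  -- The Boolean chooses which side of the matching receives which outer block; the middle block
  -- stays reserved for the matching edges.
  block : Bool → Fin 2 → Fin 3
  block false 0F = 0F
  block false 1F = 2F
  block true  0F = 2F
  block true  1F = 0F

  Element : Set
  Element = V ⊎ EdgeKind

  -- For each hub, the slot of side `1F` is the mirror image of the slot of side `0F`. At the first
  -- hub the even places of `centre` go to side `0F`, which produces slope 2.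
  spokeSlot : Fin r → Fin 2 → Fin (suc n) → Slot
  spokeSlot i 0F zero    = centre (i , 0F)
  spokeSlot i 1F zero    = centre (opposite i , 1F)
  spokeSlot i 0F (suc j) = lower (j , π j i)
  spokeSlot i 1F (suc j) = upper (opposite j , opposite (π j i))

  encode : Bool → Element → Slot
  -- Reversing the copy index here lets leaf labels fall as the matching-edge labels rise.
  encode σ (inj₁ (inj₁ (i , b)))       = own (block σ b , opposite i)
  encode σ (inj₁ (inj₂ j))             = hub j
  encode σ (inj₂ (inj₁ i))             = own (1F , i)
  encode σ (inj₂ (inj₂ ((i , b) , j))) = spokeSlot i b j

  decode : Bool → Slot → Element
  decode σ     (lower (j , i))   = inj₂ (inj₂ ((π j i , 0F) , suc j))
  decode σ     (centre (i , 0F)) = inj₂ (inj₂ ((i , 0F) , zero))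
  decode σ     (centre (i , 1F)) = inj₂ (inj₂ ((opposite i , 1F) , zero))
  decode σ     (upper (j , i))   = inj₂ (inj₂ ((π (opposite j) (opposite i) , 1F) , suc (opposite j)))
  decode σ     (own (1F , i))    = inj₂ (inj₁ i)
  decode false (own (0F , i))    = inj₁ (inj₁ (opposite i , 0F))
  decode true  (own (0F , i))    = inj₁ (inj₁ (opposite i , 1F))
  decode false (own (2F , i))    = inj₁ (inj₁ (opposite i , 1F))
  decode true  (own (2F , i))    = inj₁ (inj₁ (opposite i , 0F))
  decode σ     (hub j)           = inj₁ (inj₂ j)

  encode-decode : ∀ σ s → encode σ (decode σ s) ≡ s
  encode-decode σ     (lower (j , i))   rewrite π-involutive j i = refl
  encode-decode σ     (centre (i , 0F)) = refl
  encode-decode σ     (centre (i , 1F)) rewrite opposite-involutive i = refl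
  encode-decode σ     (upper (j , i))
    rewrite π-involutive (opposite j) (opposite i) | opposite-involutive j | opposite-involutive i = refl
  encode-decode false (own (0F , i))    rewrite opposite-involutive i = refl
  encode-decode true  (own (0F , i))    rewrite opposite-involutive i = refl
  encode-decode σ     (own (1F , i))    = refl
  encode-decode false (own (2F , i))    rewrite opposite-involutive i = refl
  encode-decode true  (own (2F , i))    rewrite opposite-involutive i = refl
  encode-decode σ     (hub j)           = refl

  decode-encode : ∀ σ x → decode σ (encode σ x) ≡ x
  decode-encode false (inj₁ (inj₁ (i , 0F)))           rewrite opposite-involutive i = refl
  decode-encode false (inj₁ (inj₁ (i , 1F)))           rewrite opposite-involutive i = refl
  decode-encode true  (inj₁ (inj₁ (i , 0F)))           rewrite opposite-involutive i = refl
  decode-encode true  (inj₁ (inj₁ (i , 1F)))           rewrite opposite-involutive i = refl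
  decode-encode σ     (inj₁ (inj₂ j))                  = refl
  decode-encode σ     (inj₂ (inj₁ i))                  = refl
  decode-encode σ     (inj₂ (inj₂ ((i , 0F) , zero)))  = refl
  decode-encode σ     (inj₂ (inj₂ ((i , 1F) , zero)))  rewrite opposite-involutive i = refl
  decode-encode σ     (inj₂ (inj₂ ((i , 0F) , suc j))) rewrite π-involutive j i = refl
  decode-encode σ     (inj₂ (inj₂ ((i , 1F) , suc j)))
    rewrite opposite-involutive j | opposite-involutive (π j i) | π-involutive j i = refl

  N≡ : N ≡ order + size
  N≡ = trans (count r n) (cong (order +_) (sym size≡kinds))
    where
    count : ∀ r n → n * r + (r * 2 + (n * r + (3 * r + suc n))) ≡ (r * 2 + suc n) + (r + r * 2 * suc n)
    count = solve-∀

  cast↔ : Fin N ↔ Fin (order + size)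
  cast↔ = mk↔ₛ′ (cast N≡) (cast (sym N≡)) (cast-involutive N≡ (sym N≡)) (cast-involutive (sym N≡) N≡)

  labeling : Bool → TotalLabeling
  labeling σ = ↔⇒⤖ (cast↔ ↔-∘ (↔-sym slot↔ ↔-∘
    (mk↔ₛ′ (encode σ) (decode σ) (encode-decode σ) (decode-encode σ) ↔-∘ (↔-id _ ⊎-↔ kind↔))))

  leafLabel-value : ∀ σ i b → leafLabel (labeling σ) i b ≡ value (own (block σ b , opposite i))
  leafLabel-value σ i b = cong suc (toℕ-cast N≡ _)

  hubLabel-value : ∀ σ j → hubLabel (labeling σ) j ≡ value (hub j)
  hubLabel-value σ j = cong suc (toℕ-cast N≡ _)

  edgeLabel-value : ∀ σ e → label (labeling σ) (inj₂ e) ≡ value (encode σ (inj₂ (kind e)))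
  edgeLabel-value σ e = cong suc (toℕ-cast N≡ _)

  rungLabel-value : ∀ σ i → rungLabel (labeling σ) i ≡ value (own (1F , i))
  rungLabel-value σ i = trans (edgeLabel-value σ (rung i))
    (cong (value ∘ encode σ ∘ inj₂) (kind-fromKind (inj₁ i)))

  spokeLabel-value : ∀ σ i b j → spokeLabel (labeling σ) i b j ≡ value (spokeSlot i b j)
  spokeLabel-value σ i b j = trans (edgeLabel-value σ (spoke (i , b) j))
    (cong (value ∘ encode σ ∘ inj₂) (kind-fromKind (inj₂ ((i , b) , j))))

  -- Constant spoke sums and the induced colors.

  K : ℕ
  K = 2 * (n * r + r) + 1

  -- The spoke labels are 1 to 2(`n * r + r`), and mirror images add up to the smallest plus the
  -- largest, which is `K`.
  spoke-pair : ∀ i j → value (spokeSlot i 0F j) + value (spokeSlot i 1F j) ≡ K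
  spoke-pair i zero = trans (cong₂ _+_ (value-centre i 0F) (value-centre (opposite i) 1F))
    (arith (toℕ i) (toℕ (opposite i)) (n * r) (opposite-sum i))
    where
    identity : ∀ x y c → suc (c + (2 * x + 0)) + suc (c + (2 * y + 1)) ≡ 2 * (c + suc (x + y)) + 1
    identity = solve-∀
    -- Substituting for `r` the sum of an index, its opposite and one leaves a polynomial identity
    -- free of subtraction.
    arith : ∀ x y c → suc (x + y) ≡ r → suc (c + (2 * x + 0)) + suc (c + (2 * y + 1)) ≡ 2 * (c + r) + 1
    arith x y c refl = identity x y c
  spoke-pair i (suc j) = trans
    (cong₂ _+_ (value-lower j (π j i)) (value-upper (opposite j) (opposite (π j i))))
    (arith (toℕ j) (toℕ (opposite j)) (toℕ (π j i)) (toℕ (opposite (π j i)))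
      (opposite-sum j) (opposite-sum (π j i)))
    where
    identity : ∀ x y a b → let n = suc (x + y); r = suc (a + b) in
      suc (r * x + a) + suc (n * r + (r * 2 + (r * y + b))) ≡ 2 * (n * r + r) + 1
    identity = solve-∀
    arith : ∀ {n r} x y a b → suc (x + y) ≡ n → suc (a + b) ≡ r →
      suc (r * x + a) + suc (n * r + (r * 2 + (r * y + b))) ≡ 2 * (n * r + r) + 1
    arith x y a b refl refl = identity x y a b

  row : Fin r → Fin 2 → ℕ
  row i b = sum (λ j → value (spokeSlot i b j))

  rows-sum : ∀ i → row i 0F + row i 1F ≡ suc n * K
  rows-sum i = trans (sym (∑-distrib-+ (λ j → value (spokeSlot i 0F j)) (λ j → value (spokeSlot i 1F j))))
    (trans (sum-cong-≗ (spoke-pair i)) (sum-const (suc n) K))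

  row₀-const : ∀ i i′ → row i 0F ≡ row i′ 0F
  -- Adding `s` supplies the missing one in each of the `s` reversed terms, so that index and
  -- opposite index combine to `s * r`.
  row₀-const i i′ = +-cancelʳ-≡ s _ _ (trans (closed i) (sym (closed i′)))
    where
    tilt : ∀ i → sum (λ j → toℕ (π j i)) ≡ s * toℕ (opposite i) + t * toℕ i
    tilt i = trans (sum-↑ s (λ j → toℕ (π j i))) (cong₂ _+_
      (trans (sum-cong-≗ {s} λ j → cong (λ k → toℕ (reflect k i)) (splitAt-↑ˡ s j t)) (sum-const s _))
      (trans (sum-cong-≗ {t} λ j → cong (λ k → toℕ (reflect k i)) (splitAt-↑ʳ s t j)) (sum-const t _)))

    base : ℕ
    base = sum {n} (λ j → suc (r * toℕ j))

    identity : ∀ c x y t base → suc (c + (2 * x + 0)) + (base + ((2 + t) * y + t * x)) + (2 + t)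
                 ≡ suc c + base + (2 + t) * suc (x + y)
    identity = solve-∀

    balance : ∀ {s} c x y base → s ≡ 2 + t →
              suc (c + (2 * x + 0)) + (base + (s * y + t * x)) + s ≡ suc c + base + s * suc (x + y)
    balance c x y base refl = identity c x y t base

    closed : ∀ i → row i 0F + s ≡ suc (n * r) + base + s * r
    closed i = begin
      row i 0F + s
        ≡⟨ cong (_+ s) (cong₂ _+_ (value-centre i 0F)
            (trans (sum-cong-≗ (λ j → value-lower j (π j i)))
            (trans (∑-distrib-+ {n} (λ j → suc (r * toℕ j)) (λ j → toℕ (π j i))) (cong (base +_) (tilt i))))) ⟩
      suc (n * r + (2 * toℕ i + 0)) + (base + (s * toℕ (opposite i) + t * toℕ i)) + s
        ≡⟨ balance (n * r) (toℕ i) (toℕ (opposite i)) base s≡2+t ⟩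
      suc (n * r) + base + s * suc (toℕ i + toℕ (opposite i))
        ≡⟨ cong (λ x → suc (n * r) + base + s * x) (opposite-sum i) ⟩
      suc (n * r) + base + s * r ∎
      where open ≡-Reasoning

  row-const : ∀ b i i′ → row i b ≡ row i′ b
  row-const 0F i i′ = row₀-const i i′
  -- The two rows have a constant sum, and the first row is constant.
  row-const 1F i i′ = +-cancelˡ-≡ (row i 0F) _ _
    (trans (rows-sum i) (trans (sym (rows-sum i′)) (cong (_+ row i′ 1F) (row₀-const i′ i))))

  hubSum : ℕ
  hubSum = sum (λ j → value (hub j))

  -- The contribution of a K₂ to the color of one end, when its other end is labeled from block `b`.
  ends : Fin r → Fin 3 → ℕ
  ends i b = value (own (1F , i)) + value (own (b , opposite i))

  -- The copy index enters once directly and once reversed, so it cancels. Only the block matters,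
  -- and the outer blocks differ by 2`r`.
  ends-closed : ∀ i b → ends i b ≡ 2 * (n * r + r * 2 + n * r + r) + 1 + r * toℕ b
  ends-closed i b = trans (cong₂ _+_ (value-own 1F i) (value-own b (opposite i)))
    (arith (toℕ i) (toℕ (opposite i)) (n * r) (toℕ b) (opposite-sum i))
    where
    identity : ∀ x y c b → let r = suc (x + y) in
      suc (c + (r * 2 + (c + (r * 1 + x)))) + suc (c + (r * 2 + (c + (r * b + y))))
        ≡ 2 * (c + r * 2 + c + r) + 1 + r * b
    identity = solve-∀
    arith : ∀ {r} x y c b → suc (x + y) ≡ r →
      suc (c + (r * 2 + (c + (r * 1 + x)))) + suc (c + (r * 2 + (c + (r * b + y))))
        ≡ 2 * (c + r * 2 + c + r) + 1 + r * b
    arith x y c b refl = identity x y c b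

  color-leaf-value : ∀ σ i b → color (labeling σ) (inj₁ (i , b)) ≡
                     ends i (block σ (opposite b)) + (row i b + hubSum)
  color-leaf-value σ i b = trans (color-leaf (labeling σ) i b) (cong₂ _+_
    (cong₂ _+_ (rungLabel-value σ i) (leafLabel-value σ i (opposite b)))
    (trans (sum-cong-≗ (λ j → cong₂ _+_ (spokeLabel-value σ i b j) (hubLabel-value σ j)))
           (∑-distrib-+ (λ j → value (spokeSlot i b j)) (λ j → value (hub j)))))

  -- Each K₂ contributes `K` from its two spokes plus both leaf labels. Exchanging the outer blocks
  -- only commutes the leaf labels, so neither `σ` nor `j` remains.
  color-hub-value : ∀ σ j → color (labeling σ) (inj₂ j) ≡
                    sum (λ i → K + (value (own (0F , opposite i)) + value (own (2F , opposite i))))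
  color-hub-value σ j = trans (color-hub (labeling σ) j) (sum-cong-≗ λ i → trans
      (cong₂ (λ x y → x + (y + 0))
        (cong₂ _+_ (spokeLabel-value σ i 0F j) (leafLabel-value σ i 0F))
        (cong₂ _+_ (spokeLabel-value σ i 1F j) (leafLabel-value σ i 1F)))
      (trans (identity (value (spokeSlot i 0F j)) _ _ _) (cong₂ _+_ (spoke-pair i j) (swap σ i))))
    where
    identity : ∀ p a q b → p + a + (q + b + 0) ≡ p + q + (a + b)
    identity = solve-∀
    swap : ∀ σ i → value (own (block σ 0F , opposite i)) + value (own (block σ 1F , opposite i)) ≡
                   value (own (0F , opposite i)) + value (own (2F , opposite i))
    swap false i = refl
    swap true  i = +-comm (value (own (2F , opposite i))) _

-- Separation of the three colors.

module ThreeColors (r′ s′ : ℕ) where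

  r : ℕ
  r = suc r′

  open Balanced r (2 + s′) s′ refl
  open MatchingJoin r (suc n)
  open Graph G
  open Labeling G

  leafColor : Bool → Fin 2 → ℕ
  leafColor σ b = ends 0F (block σ (opposite b)) + (row 0F b + hubSum)

  hubColor : ℕ
  hubColor = sum (λ i → K + (value (own (0F , opposite i)) + value (own (2F , opposite i))))

  leaf-constant : ∀ σ b i → color (labeling σ) (inj₁ (i , b)) ≡ leafColor σ b
  leaf-constant σ b i = trans (color-leaf-value σ i b)
    (cong₂ (λ x y → x + (y + hubSum))
      (trans (ends-closed i c) (sym (ends-closed 0F c)))
      (row-const b i 0F))
    where c = block σ (opposite b)

  rows-odd : ∃ λ k → row 0F 0F + row 0F 1F ≡ suc (2 * k)
  -- The sum is the product of the odd numbers 2`s′` + 3 and `K`; the witness is half of its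
  -- predecessor.
  rows-odd = (2 * s′ + 3) * (n * r + r) + suc s′ , trans (rows-sum 0F) (identity s′ (n * r + r))
    where
    identity : ∀ s c → suc (2 + s + s) * (2 * c + 1) ≡ suc (2 * ((2 * s + 3) * c + suc s))
    identity = solve-∀

  -- Rows with an odd sum have opposite parities, and an even shift preserves this. The shift is
  -- 2`r` when the sides use different outer blocks, and 0 when colors of the two labelings are
  -- compared.
  rows≢ : ∀ c → row 0F 0F + 2 * c ≢ row 0F 1F
  rows≢ c eq = even≢odd (row 0F 0F + c) (proj₁ rows-odd)
    (trans (identity (row 0F 0F) c) (trans (cong (row 0F 0F +_) eq) (proj₂ rows-odd)))
    where
    identity : ∀ x c → 2 * (x + c) ≡ x + (x + 2 * c)
    identity = solve-∀

  rows≢′ : ∀ c → row 0F 0F ≢ row 0F 1F + 2 * c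
  rows≢′ c eq = even≢odd (row 0F 1F + c) (proj₁ rows-odd)
    (trans (identity (row 0F 1F) c) (trans (cong (_+ row 0F 1F) (sym eq)) (proj₂ rows-odd)))
    where
    identity : ∀ x c → 2 * (x + c) ≡ x + 2 * c + x
    identity = solve-∀

  shift : ℕ
  shift = ends 0F 0F + hubSum

  -- The color of side `b` when its partners take the first or the last outer block, respectively.
  low high : Fin 2 → ℕ
  low  b = shift + row 0F b
  high b = shift + (row 0F b + 2 * r)

  leaf-low : ∀ b → ends 0F 0F + (row 0F b + hubSum) ≡ low b
  leaf-low b = identity (ends 0F 0F) (row 0F b) hubSum
    where
    identity : ∀ e x h → e + (x + h) ≡ e + h + x
    identity = solve-∀

  leaf-high : ∀ b → ends 0F 2F + (row 0F b + hubSum) ≡ high b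
  leaf-high b = trans
    (cong (_+ (row 0F b + hubSum)) (ends-closed 0F 2F))
    (trans (identity C r (row 0F b) hubSum)
      (cong (λ e → e + hubSum + (row 0F b + 2 * r)) (sym (ends-closed 0F 0F))))
    where
    C = 2 * (n * r + r * 2 + n * r + r) + 1
    identity : ∀ c r x h → c + r * 2 + (x + h) ≡ c + r * 0 + h + (x + 2 * r)
    identity = solve-∀

  leaf₀ leaf₁ : Bool → ℕ
  leaf₀ false = high 0F
  leaf₀ true  = low 0F
  leaf₁ false = low 1F
  leaf₁ true  = high 1F

  leaf₀-constant : ∀ σ i → color (labeling σ) (inj₁ (i , 0F)) ≡ leaf₀ σ
  leaf₀-constant false i = trans (leaf-constant false 0F i) (leaf-high 0F)
  leaf₀-constant true  i = trans (leaf-constant true  0F i) (leaf-low  0F)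

  leaf₁-constant : ∀ σ i → color (labeling σ) (inj₁ (i , 1F)) ≡ leaf₁ σ
  leaf₁-constant false i = trans (leaf-constant false 1F i) (leaf-low  1F)
  leaf₁-constant true  i = trans (leaf-constant true  1F i) (leaf-high 1F)

  leaves≢ : ∀ σ → leaf₀ σ ≢ leaf₁ σ
  leaves≢ false eq = rows≢ r (+-cancelˡ-≡ shift _ _ eq)
  leaves≢ true  eq = rows≢′ r (+-cancelˡ-≡ shift _ _ eq)

  low≢high : ∀ b → low b ≢ high b
  -- Since `r` is a successor, the difference `2 * r` is positive.
  low≢high b eq = m≢1+m+n (row 0F b) (trans (+-cancelˡ-≡ shift _ _ eq) (+-suc (row 0F b) _))

  low₀≢low₁ : low 0F ≢ low 1F
  low₀≢low₁ eq = rows≢ 0 (trans (+-identityʳ _) (+-cancelˡ-≡ shift _ _ eq))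

  high₀≢high₁ : high 0F ≢ high 1F
  high₀≢high₁ eq = rows≢ 0 (trans (+-identityʳ _) (+-cancelʳ-≡ (2 * r) _ _ (+-cancelˡ-≡ shift _ _ eq)))

  -- Each leaf color of one labeling differs from both leaf colors of the other. As the hub color is
  -- common to both labelings, a collision in the first excludes any in the second.
  avoids-hub : ∃ λ σ → leaf₀ σ ≢ hubColor × leaf₁ σ ≢ hubColor
  avoids-hub with high 0F ≟ℕ hubColor | low 1F ≟ℕ hubColor
  ... | no p   | no q   = false , p , q
  ... | yes eq | _      = true , (λ x → low≢high 0F (trans x (sym eq)))
                               , (λ x → high₀≢high₁ (trans eq (sym x)))
  ... | _      | yes eq = true , (λ x → low₀≢low₁ (trans x (sym eq)))
                               , (λ x → low≢high 1F (trans eq (sym x)))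

  χ≡3 : χltna[ copies r (complete 2) ∨ O (suc n) ]≡ 3
  χ≡3 = record
    { noIsolated = noIsolated
    ; attained = f , proper , ≤-antisym (numColors≤3 f u v h) (three≤numColors f 0F 0F proper)
    ; minimal = λ f proper → three≤numColors f 0F 0F proper
    }
    where
    noIsolated : NoIsolatedVertex
    noIsolated (inj₁ _) = inj₂ 0F , _
    noIsolated (inj₂ _) = inj₁ (0F , 0F) , _

    σ = proj₁ avoids-hub
    f = labeling σ
    u = leaf₀-constant σ
    v = leaf₁-constant σ
    h = color-hub-value σ
    proper = antimagic f u v h (leaves≢ σ) (proj₁ (proj₂ avoids-hub)) (proj₂ (proj₂ avoids-hub))

theorem2p2 : (r s : ℕ) → 1 ≤ r → 1 ≤ s →
    χltna[ copies r (complete 2) ∨ O (2 * s + 1) ]≡ 3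
theorem2p2 (suc r) (suc s) _ _ =
  -- The hubs are one of slope 2, `2 + s` reversed and `s` unreversed ones, where `s` is now one
  -- less than the theorem's parameter.
  subst (λ m → χltna[ copies (suc r) (complete 2) ∨ O m ]≡ 3) (hubs s) (ThreeColors.χ≡3 r s)
  where
  hubs : ∀ s → suc (2 + s + s) ≡ 2 * suc s + 1
  hubs = solve-∀
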